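{- The word $\mathbf{m}$ is the fixed point $\mathbf{m}=h_1(\mathbf{m})$, where $h_1$ is the morphism $h_1=[1000,1010]$ (i.e. $h_1(0)=1000$, $h_1(1)=1010$). The word $\boldsymbol{\ell}$ is the fixed point $\boldsymbol{\ell}=h_2(\boldsymbol{\ell})$, where $h_2$ is the morphism $h_2=[0001,0101]$ (i.e. $h_2(0)=0001$, $h_2(1)=0101$).
   Context: A factor of a word is a finite contiguous subword. A word $w$ encounters a pattern $p\in\{0,1\}^*$ if $g(p)$ is a factor of $w$ for some non-erasing morphism $g:\{0,1\}^*\to\{0,1\}^*$ (i.e. $g(0),g(1)$ non-empty). A (finite or one-sided infinite) binary word is good if it contains neither $11$ nor $1001$ as a factor, and encounters neither of the patterns $0000$ and $00010100$. For each non-negative integer $n$, $\ell_n$ (resp. $m_n$) is the lexicographically least (resp. greatest) binary word of length $n$, with $0<1$, that is a prefix of some one-sided infinite good word. For every $n$, $\ell_n$ is a prefix of $\ell_{n+1}$ and $m_n$ is a prefix of $m_{n+1}$; $\boldsymbol{\ell}=\lim_{n\to\infty}\ell_n$ and $\mathbf{m}=\lim_{n\to\infty}m_n$ are the one-sided infinite words having all $\ell_n$ (resp. all $m_n$) as prefixes. Morphisms are extended letterwise to infinite words. -}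

module Defs where

open import Data.Fin.Base using (Fin; toℕ; _<_)
open import Data.Fin.Patterns using (0F; 1F)
open import Data.List.Base using (List; []; _∷_; length; concatMap)
open import Data.List.NonEmpty.Base using (List⁺; _∷_; head; tail; toList)
open import Data.Nat.Base using (ℕ; zero; suc; _+_)
open import Data.Product.Base using (∃; _×_)
open import Data.Vec.Base using (Vec; tabulate; fromList)
open import Data.Vec.Relation.Binary.Lex.Strict using (Lex-≤)
open import Function.Base using (_∘_)
open import Relation.Binary.PropositionalEquality using (_≡_; _≗_)
open import Relation.Nullary.Negation.Core using (¬_)

Letter : Set
Letter = Fin 2

Word : Set
Word = List Letter

-- One-sided infinite words; they are compared pointwise, by _≗_.
Word∞ : Set
Word∞ = ℕ → Letter

prefix : (n : ℕ) → Word∞ → Vec Letter n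
prefix n w = tabulate (w ∘ toℕ)

suffix : ℕ → Word∞ → Word∞
suffix i w j = w (i + j)

_IsFactorOf_ : Word → Word∞ → Set
u IsFactorOf w = ∃ λ i → prefix (length u) (suffix i w) ≡ fromList u

-- A morphism is given by the images of the letters, which are non-empty lists
-- because only non-erasing morphisms occur.
Morphism : Set
Morphism = Letter → List⁺ Letter

apply : Morphism → Word → Word
apply g = concatMap (toList ∘ g)

-- applyFrom g a u w is the infinite word a u g(w).
applyFrom : Morphism → Letter → Word → Word∞ → Word∞
applyFrom g a u       w zero    = a
applyFrom g a (b ∷ u) w (suc n) = applyFrom g b u w n
applyFrom g a []      w (suc n) =
  applyFrom g (head (g (w 0))) (tail (g (w 0))) (suffix 1 w) n

apply∞ : Morphism → Word∞ → Word∞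
apply∞ g w = applyFrom g (head (g (w 0))) (tail (g (w 0))) (suffix 1 w)

_Encounters_ : Word∞ → Word → Set
w Encounters p = ∃ λ (g : Morphism) → apply g p IsFactorOf w

record Good (w : Word∞) : Set where
  field
    no-11       : ¬ (1F ∷ 1F ∷ []) IsFactorOf w
    no-1001     : ¬ (1F ∷ 0F ∷ 0F ∷ 1F ∷ []) IsFactorOf w
    no-0000     : ¬ w Encounters (0F ∷ 0F ∷ 0F ∷ 0F ∷ [])
    no-00010100 : ¬ w Encounters
                    (0F ∷ 0F ∷ 0F ∷ 1F ∷ 0F ∷ 1F ∷ 0F ∷ 0F ∷ [])

IsGoodPrefix : ∀ {n} → Vec Letter n → Set
IsGoodPrefix {n} u = ∃ λ (w : Word∞) → Good w × prefix n w ≡ u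

infix 4 _≤ₗₑₓ_

_≤ₗₑₓ_ : ∀ {n} → Vec Letter n → Vec Letter n → Set
_≤ₗₑₓ_ = Lex-≤ _≡_ _<_

IsLeastGoodPrefix : ∀ {n} → Vec Letter n → Set
IsLeastGoodPrefix {n} u =
  IsGoodPrefix u × (∀ (v : Vec Letter n) → IsGoodPrefix v → u ≤ₗₑₓ v)

IsGreatestGoodPrefix : ∀ {n} → Vec Letter n → Set
IsGreatestGoodPrefix {n} u =
  IsGoodPrefix u × (∀ (v : Vec Letter n) → IsGoodPrefix v → v ≤ₗₑₓ u)

-- The words ℓₙ, mₙ and their limits ℓ, m are specified by predicates, since
-- being a prefix of some infinite good word is not decidable by definition.
-- Least and greatest elements are unique, so each predicate determines its
-- word (up to _≗_ for the infinite ones).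
IsLimitOfLeast : Word∞ → Set
IsLimitOfLeast ℓ = ∀ n → IsLeastGoodPrefix (prefix n ℓ)

IsLimitOfGreatest : Word∞ → Set
IsLimitOfGreatest m = ∀ n → IsGreatestGoodPrefix (prefix n m)

IsFixedPoint : Morphism → Word∞ → Set
IsFixedPoint h w = w ≗ apply∞ h w

IsTheFixedPoint : Morphism → Word∞ → Set
IsTheFixedPoint h w = IsFixedPoint h w × (∀ v → IsFixedPoint h v → v ≗ w)

h₁ : Morphism
h₁ 0F = 1F ∷ 0F ∷ 0F ∷ 0F ∷ []
h₁ 1F = 1F ∷ 0F ∷ 1F ∷ 0F ∷ []

h₂ : Morphism
h₂ 0F = 0F ∷ 0F ∷ 0F ∷ 1F ∷ []
h₂ 1F = 0F ∷ 1F ∷ 0F ∷ 1F ∷ []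

{-# OPTIONS --safe #-}

-- Let σ₀ = [10,00] and σ₁ = [01,00]; both reverse the lexicographic order, and
-- h₁ = σ₀ ∘ σ₁, h₂ = σ₁ ∘ σ₀.  The fixed points W₀ of h₁ and W₁ of h₂ satisfy
-- W₀ = σ₀(W₁) and W₁ = σ₁(W₀).
--
-- They are good: two positions of σ_c(v) at odd distance never both carry a 1,
-- which forces a long run of zeros when a period |g(0)| or |g(0)| + |g(1)| is
-- odd, except in one configuration that dies one level down.  If |g(0)| and
-- |g(1)| are both even, the occurrence is the image of one of half the size.
--
-- They are extremal: in a good word successive 1s are at distance 2 or 4, so a
-- good word that starts with 1 is σ₀(v), and one that starts with 000 is σ₁(v),
-- with v good; so a first difference from W_c comes from an earlier one between
-- the preimages, in the reversed order.
module Submission where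

open import Defs
open import Data.Empty using (⊥; ⊥-elim)
open import Data.Fin.Base as Fin using (toℕ; opposite)
open import Data.Fin.Patterns using (0F; 1F)
open import Data.Fin.Properties as Fin using (opposite-involutive; toℕ<n)
open import Data.List.Base using ([]; _∷_; _++_; length)
open import Data.List.NonEmpty.Base using (_∷_; head; tail; toList; _⁺++_)
open import Data.List.Properties using (concatMap-++)
open import Data.Nat.Base
open import Data.Nat.DivMod using (_divMod_; result)
open import Data.Nat.GeneralisedArithmetic using (fold)
open import Data.Nat.Induction using (Acc; acc; <-wellFounded)
open import Data.Nat.Properties hiding (≤-antisym)
open import Data.Nat.Solver using (module +-*-Solver)
open import Data.Product.Base using (∃; _×_; _,_; proj₁; proj₂)
open import Data.Sum.Base using (_⊎_; inj₁; inj₂; map; map₂)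
open import Data.Vec.Base using (Vec; []; _∷_; fromList)
open import Data.Vec.Properties using (∷-injectiveˡ; ∷-injectiveʳ)
open import Data.Vec.Relation.Binary.Lex.Strict using (base; this; next; ≤-antisym)
open import Data.Vec.Relation.Binary.Pointwise.Inductive using (Pointwise-≡⇒≡)
open import Function.Base using (_∘_; const; case_of_)
open import Relation.Binary.PropositionalEquality
open import Relation.Nullary.Negation.Core using (¬_)

private
  variable
    c : Letter
    k l n : ℕ
    v w v′ w′ : Word∞

-- Letters and parity of positions

0≢1 : {x : Letter} → x ≡ 0F → x ≡ 1F → ⊥
0≢1 refl ()

opposite-injective : {x y : Letter} → opposite x ≡ opposite y → x ≡ y
opposite-injective {x} {y} eq =
  trans (sym (opposite-involutive x)) (trans (cong opposite eq) (opposite-involutive y))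

-- In `σ c v` the first case is a position that carries a letter of `v`, the second one that carries
-- an inserted 0.
position : ∀ (c : Letter) n → ∃ λ j → n ≡ toℕ c + j * 2 ⊎ n ≡ toℕ (opposite c) + j * 2
position 0F n with n divMod 2
... | result j 0F eq = j , inj₁ eq
... | result j 1F eq = j , inj₂ eq
position 1F n with n divMod 2
... | result j 0F eq = j , inj₂ eq
... | result j 1F eq = j , inj₁ eq

infix 4 _≗[_]_

_≗[_]_ : Word∞ → ℕ → Word∞ → Set
v ≗[ n ] w = ∀ j → j < n → v j ≡ w j

-- The morphisms σ₀ and σ₁

-- The two phases are interleaved: `σ 1F v` is 0 followed by `σ 0F v`, so dropping one letter
-- switches the phase.
σ : Letter → Word∞ → Word∞
σ 0F v zero    = opposite (v 0)
σ 0F v (suc n) = σ 1F (suffix 1 v) n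
σ 1F v zero    = 0F
σ 1F v (suc n) = σ 0F v n

σ-cong : ∀ c → v ≗ w → σ c v ≗ σ c w
σ-cong 0F eq zero    = cong opposite (eq 0)
σ-cong 0F eq (suc n) = σ-cong 1F (eq ∘ suc) n
σ-cong 1F eq zero    = refl
σ-cong 1F eq (suc n) = σ-cong 0F eq n

-- What matters is the letter gained from the leading 0 of σ₁: it makes the composition of both
-- morphisms lengthen an agreement.
σ-agree : ∀ c → v ≗[ n ] w → σ c v ≗[ toℕ c + n ] σ c w
σ-agree             0F eq zero    0<n       = cong opposite (eq 0 0<n)
σ-agree {n = suc n} 0F eq (suc j) (s≤s j<n) =
  σ-agree 1F (λ i i<n → eq (suc i) (s<s i<n)) j (m<n⇒m<1+n j<n)
σ-agree             1F eq zero    _         = refl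
σ-agree             1F eq (suc j) (s≤s j<n) = σ-agree 0F eq j j<n

σ₀-even : ∀ v j → σ 0F v (j * 2) ≡ opposite (v j)
σ₀-even v zero    = refl
σ₀-even v (suc j) = σ₀-even (suffix 1 v) j

σ₁-even : ∀ v j → σ 1F v (j * 2) ≡ 0F
σ₁-even v zero    = refl
σ₁-even v (suc j) = σ₁-even (suffix 1 v) j

σ-letter : ∀ c v j → σ c v (toℕ c + j * 2) ≡ opposite (v j)
σ-letter 0F v j = σ₀-even v j
σ-letter 1F v j = σ₀-even v j

σ-ones : ∀ c → const 0F ≗ σ c (const 1F)
σ-ones 0F zero    = refl
σ-ones 0F (suc n) = σ-ones 1F n
σ-ones 1F zero    = refl
σ-ones 1F (suc n) = σ-ones 0F n

σ-zero : ∀ c v j → σ c v (toℕ (opposite c) + j * 2) ≡ 0F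
σ-zero 0F v j = σ₁-even (suffix 1 v) j
σ-zero 1F v j = σ₁-even v j

σ-suffix : ∀ c d v → suffix (d * 2) (σ c v) ≗ σ c (suffix d v)
σ-suffix c  zero    v n = refl
σ-suffix 0F (suc d) v n = σ-suffix 0F d (suffix 1 v) n
σ-suffix 1F (suc d) v n = σ-suffix 1F d (suffix 1 v) n

record _ImageOf_[_] (w : Word∞) (v : Word∞) (c : Letter) : Set where
  constructor image
  field
    letters : w ≗ σ c v

open _ImageOf_[_]

even-suffix : ∀ d → w ImageOf v [ c ] → suffix (d * 2) w ImageOf suffix d v [ c ]
even-suffix {v = v} {c = c} d (image eq) = image λ n → trans (eq (d * 2 + n)) (σ-suffix c d v n)

suffix₁-image : w ImageOf v [ c ] → ∃ λ u → suffix 1 w ImageOf u [ opposite c ]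
suffix₁-image {c = 0F} (image eq) = _ , image (eq ∘ suc)
suffix₁-image {c = 1F} (image eq) = _ , image (eq ∘ suc)

odd-suffix : ∀ d → w ImageOf v [ c ] → ∃ λ u → suffix (1 + d * 2) w ImageOf u [ opposite c ]
odd-suffix d im = _ , even-suffix d (proj₂ (suffix₁-image im))

σ-disjoint : ∀ c v w j → σ c v j ≡ 0F ⊎ σ (opposite c) w j ≡ 0F
σ-disjoint 0F v w zero    = inj₂ refl
σ-disjoint 0F v w (suc j) = σ-disjoint 1F (suffix 1 v) w j
σ-disjoint 1F v w zero    = inj₁ refl
σ-disjoint 1F v w (suc j) = σ-disjoint 0F v (suffix 1 w) j

-- At every position one of the two phases has an inserted 0, so images in different phases can
-- share only zeros.
opposite-phases : w ImageOf v [ c ] → w′ ImageOf v′ [ opposite c ] →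
                  w ≗[ n ] w′ → w ≗[ n ] const 0F
opposite-phases {v = v} {c = c} {v′ = v′} (image eq) (image eq′) agree j j<n with σ-disjoint c v v′ j
... | inj₁ z = trans (eq j) z
... | inj₂ z = trans (agree j j<n) (trans (eq′ j) z)

no-ones-at-odd-distance : ∀ d → w ImageOf v [ c ] → w 0 ≡ 1F → w (1 + d * 2) ≡ 1F → ⊥
no-ones-at-odd-distance {v = v} {c = 0F} d (image eq) _ w≡1 =
  0≢1 (trans (eq _) (σ-zero 0F v d)) w≡1
no-ones-at-odd-distance {c = 1F} d (image eq) w₀ _ = 0≢1 (eq 0) w₀

halve : w ImageOf v [ c ] → w′ ImageOf v′ [ c ] → w ≗[ n * 2 ] w′ → v ≗[ n ] v′
halve {w} {v} {c} {w′} {v′} {n} (image eq) (image eq′) agree j j<n = opposite-injective (begin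
  opposite (v j)           ≡⟨ σ-letter c v j ⟨
  σ c v (toℕ c + j * 2)    ≡⟨ eq _ ⟨
  -- As `toℕ c` is at most 1, the position is below 2(j + 1), hence below 2n.
  w (toℕ c + j * 2)        ≡⟨ agree _ (<-≤-trans (+-monoˡ-< (j * 2) (toℕ<n c)) (*-monoˡ-≤ 2 j<n)) ⟩
  w′ (toℕ c + j * 2)       ≡⟨ eq′ _ ⟩
  σ c v′ (toℕ c + j * 2)   ≡⟨ σ-letter c v′ j ⟩
  opposite (v′ j)          ∎)
  where open ≡-Reasoning

-- Compositions of σ₀ and σ₁

σσ-agree : ∀ c → v ≗[ n ] w → σ c (σ (opposite c) v) ≗[ suc n ] σ c (σ (opposite c) w)
σσ-agree 0F eq = σ-agree 0F (σ-agree 1F eq)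
σσ-agree 1F eq = σ-agree 1F (σ-agree 0F eq)

-- A contraction argument: each use of the two equations lengthens the agreement by one letter.
σσ-fixed-unique : ∀ c → v ≗ σ c (σ (opposite c) v) → w ≗ σ c (σ (opposite c) w) → v ≗ w
σσ-fixed-unique {v} {w} c eq eq′ n = go (suc n) n ≤-refl
  where
  go : ∀ n → v ≗[ n ] w
  go (suc n) j j<n = trans (eq j) (trans (σσ-agree c (go n) j j<n) (sym (eq′ j)))

apply∞-h₁ : ∀ w → apply∞ h₁ w ≗ σ 0F (σ 1F w)
apply∞-h₁ w 0 with w 0
... | 0F = refl
... | 1F = refl
apply∞-h₁ w 1 with w 0
... | 0F = refl
... | 1F = refl
apply∞-h₁ w 2 with w 0
... | 0F = refl
... | 1F = refl
apply∞-h₁ w 3 with w 0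
... | 0F = refl
... | 1F = refl
apply∞-h₁ w (suc (suc (suc (suc n)))) with w 0
... | 0F = apply∞-h₁ (suffix 1 w) n
... | 1F = apply∞-h₁ (suffix 1 w) n

apply∞-h₂ : ∀ w → apply∞ h₂ w ≗ σ 1F (σ 0F w)
apply∞-h₂ w 0 with w 0
... | 0F = refl
... | 1F = refl
apply∞-h₂ w 1 with w 0
... | 0F = refl
... | 1F = refl
apply∞-h₂ w 2 with w 0
... | 0F = refl
... | 1F = refl
apply∞-h₂ w 3 with w 0
... | 0F = refl
... | 1F = refl
apply∞-h₂ w (suc (suc (suc (suc n)))) with w 0
... | 0F = apply∞-h₂ (suffix 1 w) n
... | 1F = apply∞-h₂ (suffix 1 w) n

-- The fixed points

approx : Letter → ℕ → Word∞
approx c = fold (const 0F) (σ c ∘ σ (opposite c))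

-- By `approx-agree`, the letter at position `n` no longer changes from iterate `suc n` on.
W : Letter → Word∞
W c n = approx c (suc n) n

approx-agree : ∀ c n → approx c n ≗[ n ] approx c (suc n)
approx-agree c (suc n) = σσ-agree c (approx-agree c n)

W-approx : ∀ c n → W c ≗[ n ] approx c n
W-approx c (suc n) j j<1+n with m<1+n⇒m<n∨m≡n j<1+n
... | inj₁ j<n  = trans (W-approx c n j j<n) (approx-agree c n j j<n)
... | inj₂ refl = refl

W-fixed : ∀ c → W c ≗ σ c (σ (opposite c) (W c))
W-fixed c n = sym (σσ-agree c (W-approx c n) n ≤-refl)

-- `σ c (W (opposite c))` is fixed by the same composition as `W c`, so uniqueness identifies them.
W-image : ∀ c → W c ImageOf W (opposite c) [ c ]
W-image 0F = image (σσ-fixed-unique 0F (W-fixed 0F) (σ-cong 0F (W-fixed 1F)))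
W-image 1F = image (σσ-fixed-unique 1F (W-fixed 1F) (σ-cong 1F (W-fixed 0F)))

-- Goodness of the fixed points

-- The index counts how many times σ₀ or σ₁ can be undone.
data Desubstitutable : ℕ → Word∞ → Set where
  stop : Desubstitutable zero w
  step : w ImageOf v [ c ] → Desubstitutable n v → Desubstitutable (suc n) w

suffix₁-desubstitutable : Desubstitutable n w → Desubstitutable n (suffix 1 w)
suffix₁-desubstitutable stop = stop
suffix₁-desubstitutable (step {c = 0F} (image eq) D) =
  step {c = 1F} (image (eq ∘ suc)) (suffix₁-desubstitutable D)
suffix₁-desubstitutable (step {c = 1F} (image eq) D) =
  step {c = 0F} (image (eq ∘ suc)) D

suffix-desubstitutable : ∀ i → Desubstitutable n w → Desubstitutable n (suffix i w)
suffix-desubstitutable zero    D = D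
suffix-desubstitutable (suc i) D = suffix-desubstitutable i (suffix₁-desubstitutable D)

W-desubstitutable : ∀ n c → Desubstitutable n (W c)
W-desubstitutable zero    c = stop
W-desubstitutable (suc n) c = step (W-image c) (W-desubstitutable n (opposite c))

-- In either phase 0000 comes from 11 one level down, where two 1s would be at distance 1.
no-four-zeros : Desubstitutable (2 + n) w → w ≗[ 4 ] const 0F → ⊥
no-four-zeros (step {v = v} {c = c} eq (step eq′ _)) zeros =
  no-ones-at-odd-distance 0 eq′ (v≡1 0 z<s) (v≡1 1 (s<s z<s))
  where
  v≡1 : ∀ j → j < 2 → v j ≡ 1F
  v≡1 = halve eq (image (σ-ones c)) zeros

no-square-of-zeros : Desubstitutable (2 + n) w → 1 < k →
                     w ≗[ k ] const 0F → w ≗[ k ] suffix k w → ⊥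
no-square-of-zeros {w = w} {k = suc (suc k)} D (s<s z<s) zeros square =
  -- The four zeros are the last two letters of the first block and the first two of the second.
  no-four-zeros (suffix-desubstitutable k D) zeros′
  where
  second : ∀ j → j < 2 + k → w (2 + k + j) ≡ 0F
  second j j<k = trans (sym (square j j<k)) (zeros j j<k)
  zeros′ : suffix k w ≗[ 4 ] const 0F
  zeros′ 0 _ = trans (cong w (+-identityʳ k)) (zeros k (m<n⇒m<1+n ≤-refl))
  zeros′ 1 _ = trans (cong w (+-comm k 1)) (zeros (suc k) ≤-refl)
  zeros′ 2 _ = trans (cong w (+-suc k 1)) (trans (cong (w ∘ suc) (+-suc k 0)) (second 0 z<s))
  zeros′ 3 _ = trans (cong w (+-suc k 2)) (trans (cong (w ∘ suc) (+-suc k 1)) (second 1 (s<s z<s)))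
  zeros′ (suc (suc (suc (suc _)))) (s≤s (s≤s (s≤s (s≤s ()))))

half-positive : ∀ k → 0 < k * 2 → 0 < k
half-positive (suc k) _ = z<s

half-bound : ∀ k → k * 2 ≤ suc n → k ≤ n
half-bound zero    _        = z≤n
half-bound (suc k) (s≤s le) = ≤-trans (s≤s (m≤m*n k 2)) le

-- Induction on a bound `n` for the period. Halving an even period uses one level of desubstitution;
-- the two levels beyond `n` serve to exclude 0000.
no-fourth-power : ∀ n → Desubstitutable (2 + n) w → 0 < k → k ≤ n →
  w ≗[ k ] suffix k w →
  w ≗[ k ] suffix k (suffix k w) →
  w ≗[ k ] suffix k (suffix k (suffix k w)) → ⊥
no-fourth-power zero _ (s≤s _) () _ _ _
no-fourth-power {k = k} (suc n) D@(step eq D′) 0<k k≤n a₁ a₂ a₃ with position 0F k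
... | j , inj₁ refl =
  let eq₁ = even-suffix j eq
      eq₂ = even-suffix j eq₁
      eq₃ = even-suffix j eq₂
  in no-fourth-power n D′ (half-positive j 0<k) (half-bound j k≤n)
       (halve eq eq₁ a₁) (halve eq eq₂ a₂) (halve eq eq₃ a₃)
-- At odd distance the phases differ, so the block is zero. Period 1 is separate, since two blocks
-- then give only 00.
... | suc j , inj₂ refl =
  no-square-of-zeros D (s<s z<s) (opposite-phases eq (proj₂ (odd-suffix (suc j) eq)) a₁) a₁
... | zero , inj₂ refl = no-four-zeros D λ where
    0 _ → w₀
    1 _ → trans (sym (a₁ 0 z<s)) w₀
    2 _ → trans (sym (a₂ 0 z<s)) w₀
    3 _ → trans (sym (a₃ 0 z<s)) w₀
    (suc (suc (suc (suc _)))) (s≤s (s≤s (s≤s (s≤s ()))))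
  where w₀ = opposite-phases eq (proj₂ (odd-suffix 0 eq)) a₁ 0 z<s

-- With |g(0)| = k and |g(1)| = l, the blocks of g(00010100) start at
-- 0, k, 2k, 3k, 3k + l, 4k + l, 4k + 2l and 5k + 2l.
no-aaababaa : ∀ n → Desubstitutable (2 + n) w → 0 < k → 0 < l → k ≤ n →
  let w₁ = suffix k w ; w₂ = suffix k w₁ ; w₃ = suffix k w₂ ; w₄ = suffix l w₃
      w₅ = suffix k w₄ ; w₆ = suffix l w₅ ; w₇ = suffix k w₆
  in w ≗[ k ] w₁ → w ≗[ k ] w₂ → w ≗[ k ] w₄ → w ≗[ k ] w₇ → w₃ ≗[ l ] w₅ → ⊥
no-aaababaa zero _ (s≤s _) _ () _ _ _ _ _
no-aaababaa {k = k} {l = l} (suc n) D@(step {c = c} eq D′) 0<k 0<l k≤n a₁ a₂ a₄ a₇ b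
  with position 0F k | position 0F l
... | j , inj₁ refl | i , inj₁ refl =
  let eq₁ = even-suffix j eq
      eq₂ = even-suffix j eq₁
      eq₃ = even-suffix j eq₂
      eq₄ = even-suffix i eq₃
      eq₅ = even-suffix j eq₄
      eq₆ = even-suffix i eq₅
      eq₇ = even-suffix j eq₆
  in no-aaababaa n D′ (half-positive j 0<k) (half-positive i 0<l) (half-bound j k≤n)
       (halve eq eq₁ a₁) (halve eq eq₂ a₂) (halve eq eq₄ a₄) (halve eq eq₇ a₇) (halve eq₃ eq₅ b)
-- The block at `w₄` is at the odd distance 3k + l from the first one, so g(0) consists of zeros.
... | suc j , inj₁ refl | i , inj₂ refl =
  let eq₃ = even-suffix (suc j) (even-suffix (suc j) (even-suffix (suc j) eq))
  in no-square-of-zeros D (s<s z<s) (opposite-phases eq (proj₂ (odd-suffix i eq₃)) a₄) a₁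
... | suc j , inj₂ refl | _ =
  no-square-of-zeros D (s<s z<s) (opposite-phases eq (proj₂ (odd-suffix (suc j) eq)) a₁) a₁
... | zero , inj₂ refl | i , inj₁ refl = no-four-zeros D λ where
    0 _ → w₀
    1 _ → trans (sym (a₁ 0 z<s)) w₀
    2 _ → trans (sym (a₂ 0 z<s)) w₀
    -- The two copies of g(1) are at the odd distance l + 1, so g(1) starts with a 0 that extends
    -- 000.
    3 _ → opposite-phases eq₃ (proj₂ (odd-suffix 0 (even-suffix i eq₃))) b 0 0<l
    (suc (suc (suc (suc _)))) (s≤s (s≤s (s≤s (s≤s ()))))
  where
  w₀ = opposite-phases eq (proj₂ (odd-suffix 0 eq)) a₁ 0 z<s
  eq₃ = proj₂ (odd-suffix 0 (proj₂ (odd-suffix 0 (proj₂ (odd-suffix 0 eq)))))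
-- Here g(00010100) = 000b0b00 with |b| = l odd.  If w = σ₀(v), then 000 comes
-- from 11 in v; if w = σ₁(v), the zeros at 1 and 2l + 5 are the images of two
-- 1s of v at the odd distance l + 2.
no-aaababaa {w = w} (suc n) (step {v = v} {c = c} (image eq) (step eq′ _)) _ _ _ a₁ a₂ _ a₇ _
    | zero , inj₂ refl | i , inj₂ refl with c
... | 0F = no-ones-at-odd-distance 0 eq′ (v≡1 0 w₀) (v≡1 1 w₂)
  where
  v≡1 : ∀ j → w (j * 2) ≡ 0F → v j ≡ 1F
  v≡1 j w≡0 = opposite-injective (trans (sym (σ-letter 0F v j)) (trans (sym (eq _)) w≡0))
  w₀ : w 0 ≡ 0F
  w₀ = trans (a₁ 0 z<s) (trans (eq 1) (σ-zero 0F v 0))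
  w₂ : w 2 ≡ 0F
  w₂ = trans (sym (a₂ 0 z<s)) w₀
... | 1F = no-ones-at-odd-distance (1 + i) eq′ (v≡1 0 w₁) (v≡1 (3 + i * 2) w₇)
  where
  v≡1 : ∀ j → w (1 + j * 2) ≡ 0F → v j ≡ 1F
  v≡1 j w≡0 = opposite-injective (trans (sym (σ-letter 1F v j)) (trans (sym (eq _)) w≡0))
  w₁ : w 1 ≡ 0F
  w₁ = trans (sym (a₁ 0 z<s)) (eq 0)
  offset : ∀ i → 3 + ((1 + i * 2) + (1 + ((1 + i * 2) + 1))) ≡ 1 + (3 + i * 2) * 2
  offset = solve 1 (λ i → con 3 :+ ((con 1 :+ i :* con 2) :+ (con 1 :+ ((con 1 :+ i :* con 2) :+ con 1)))
                          := con 1 :+ (con 3 :+ i :* con 2) :* con 2) refl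
    where open +-*-Solver
  w₇ : w (1 + (3 + i * 2) * 2) ≡ 0F
  w₇ = trans (cong w (sym (offset i))) (trans (sym (a₇ 0 z<s)) (eq 0))

-- Prefixes, factors and goodness

infix 4 _StartsWith_

-- One equation per letter, so that a factor can be cut into the blocks g(0) and g(1) and matched
-- on.
data _StartsWith_ (w : Word∞) : Word → Set where
  []  : w StartsWith []
  _∷_ : ∀ {a x} → w 0 ≡ a → suffix 1 w StartsWith x → w StartsWith a ∷ x

startsWith⁺ : ∀ w x → prefix (length x) w ≡ fromList x → w StartsWith x
startsWith⁺ w []      _  = []
startsWith⁺ w (a ∷ x) eq = ∷-injectiveˡ eq ∷ startsWith⁺ (suffix 1 w) x (∷-injectiveʳ eq)

startsWith⁻ : ∀ {x} → w StartsWith x → prefix (length x) w ≡ fromList x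
startsWith⁻ []       = refl
startsWith⁻ (eq ∷ s) = cong₂ _∷_ eq (startsWith⁻ s)

factor : ∀ w i {x} → suffix i w StartsWith x → x IsFactorOf w
factor w i s = i , startsWith⁻ s

startsWith-resp : ∀ {x} → v ≗ w → v StartsWith x → w StartsWith x
startsWith-resp eq []      = []
startsWith-resp eq (e ∷ s) = trans (sym (eq 0)) e ∷ startsWith-resp (eq ∘ suc) s

startsWith-++ : ∀ x {y} → w StartsWith x ++ y → w StartsWith x × suffix (length x) w StartsWith y
startsWith-++ []      s = [] , s
startsWith-++ (a ∷ x) (e ∷ s) = let s₁ , s₂ = startsWith-++ x s in e ∷ s₁ , s₂

startsWith-agree : ∀ {x} → v StartsWith x → w StartsWith x → v ≗[ length x ] w
startsWith-agree (d ∷ s) (e ∷ t) zero    _         = trans d (sym e)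
startsWith-agree (d ∷ s) (e ∷ t) (suc j) (s≤s j<n) = startsWith-agree s t j j<n

desubstitutable⇒good : (∀ n → Desubstitutable n w) → Good w
desubstitutable⇒good {w} D = record
  { no-11       = λ (i , s) → case startsWith⁺ (suffix i w) _ s of λ where
      (w₀ ∷ w₁ ∷ []) → ones-apart i 0 w₀ w₁
  ; no-1001     = λ (i , s) → case startsWith⁺ (suffix i w) _ s of λ where
      (w₀ ∷ _ ∷ _ ∷ w₃ ∷ []) → ones-apart i 1 w₀ w₃
  ; no-0000     = λ (g , i , s) →
      let a = toList (g 0F)
          s₀ , r₀ = startsWith-++ a (startsWith⁺ (suffix i w) _ s)
          s₁ , r₁ = startsWith-++ a r₀
          s₂ , r₂ = startsWith-++ a r₁
          s₃ , _  = startsWith-++ a r₂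
      in no-fourth-power (length a) (tails i _) z<s ≤-refl
           (startsWith-agree s₀ s₁) (startsWith-agree s₀ s₂) (startsWith-agree s₀ s₃)
  ; no-00010100 = λ (g , i , s) →
      let a = toList (g 0F)
          b = toList (g 1F)
          s₀ , r₀ = startsWith-++ a (startsWith⁺ (suffix i w) _ s)
          s₁ , r₁ = startsWith-++ a r₀
          s₂ , r₂ = startsWith-++ a r₁
          s₃ , r₃ = startsWith-++ b r₂
          s₄ , r₄ = startsWith-++ a r₃
          s₅ , r₅ = startsWith-++ b r₄
          s₆ , r₆ = startsWith-++ a r₅
          s₇ , _  = startsWith-++ a r₆
      in no-aaababaa (length a) (tails i _) z<s z<s ≤-refl
           (startsWith-agree s₀ s₁) (startsWith-agree s₀ s₂) (startsWith-agree s₀ s₄)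
           (startsWith-agree s₀ s₇) (startsWith-agree s₃ s₅)
  }
  where
  tails : ∀ i n → Desubstitutable n (suffix i w)
  tails i n = suffix-desubstitutable i (D n)
  ones-apart : ∀ i d → suffix i w 0 ≡ 1F → suffix i w (1 + d * 2) ≡ 1F → ⊥
  ones-apart i d with tails i 1
  ... | step im _ = no-ones-at-odd-distance d im

W-good : ∀ c → Good (W c)
W-good c = desubstitutable⇒good λ n → W-desubstitutable n c

-- Preimages of good words

τ : Letter → Morphism
τ 0F a = opposite a ∷ 0F ∷ []
τ 1F a = 0F ∷ opposite a ∷ []

σ-startsWith : ∀ c {x} → v StartsWith x → σ c v StartsWith apply (τ c) x
σ-startsWith c  []      = []
σ-startsWith 0F (e ∷ s) = cong opposite e ∷ refl ∷ σ-startsWith 0F s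
σ-startsWith 1F (e ∷ s) = refl ∷ cong opposite e ∷ σ-startsWith 1F s

image-factor : ∀ {x} → w ImageOf v [ c ] → x IsFactorOf v → apply (τ c) x IsFactorOf w
image-factor {w} {v} {c} im (i , s) =
  factor w (i * 2) (startsWith-resp (sym ∘ letters (even-suffix i im))
                                    (σ-startsWith c (startsWith⁺ (suffix i v) _ s)))

_⊙_ : Morphism → Morphism → Morphism
(h ⊙ g) a = h (head (g a)) ⁺++ apply h (tail (g a))

apply-⊙ : ∀ h g x → apply (h ⊙ g) x ≡ apply h (apply g x)
apply-⊙ h g []      = refl
apply-⊙ h g (a ∷ x) = trans (cong (toList ((h ⊙ g) a) ++_) (apply-⊙ h g x))
                            (sym (concatMap-++ (toList ∘ h) (toList (g a)) (apply g x)))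

image-encounters : ∀ p → w ImageOf v [ c ] → v Encounters p → w Encounters p
image-encounters {w} {c = c} p im (g , f) =
  τ c ⊙ g , subst (_IsFactorOf w) (sym (apply-⊙ (τ c) g p)) (image-factor {x = apply g p} im f)

-- The identity morphism, through which a factor counts as an encounter.
pure : Morphism
pure a = a ∷ []

-- Encounters pass to the image by composing morphisms, and both σ₀ and σ₁ send 11 to 0000.
-- Excluding 1001 depends on the phase, so it is a hypothesis.
good-preimage : Good w → w ImageOf v [ c ] → ¬ (1F ∷ 0F ∷ 0F ∷ 1F ∷ []) IsFactorOf v → Good v
good-preimage {w} {v} {c} G im ¬1001 = record
  { no-11       = no-11 c im
  ; no-1001     = ¬1001
  ; no-0000     = Good.no-0000 G ∘ image-encounters (0F ∷ 0F ∷ 0F ∷ 0F ∷ []) im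
  ; no-00010100 = Good.no-00010100 G ∘
      image-encounters (0F ∷ 0F ∷ 0F ∷ 1F ∷ 0F ∷ 1F ∷ 0F ∷ 0F ∷ []) im
  }
  where
  no-11 : ∀ c → w ImageOf v [ c ] → ¬ (1F ∷ 1F ∷ []) IsFactorOf v
  no-11 0F im f = Good.no-0000 G (pure , image-factor {x = 1F ∷ 1F ∷ []} im f)
  no-11 1F im f = Good.no-0000 G (pure , image-factor {x = 1F ∷ 1F ∷ []} im f)

good-suffix₁ : Good w → Good (suffix 1 w)
good-suffix₁ G = record
  { no-11       = λ (i , s) → no-11 (suc i , s)
  ; no-1001     = λ (i , s) → no-1001 (suc i , s)
  ; no-0000     = λ (g , i , s) → no-0000 (g , suc i , s)
  ; no-00010100 = λ (g , i , s) → no-00010100 (g , suc i , s)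
  }
  where open Good G

-- σ₁(1001) = 00010100.
no-1001-in-σ₁-preimage : Good w → w ImageOf v [ 1F ] → ¬ (1F ∷ 0F ∷ 0F ∷ 1F ∷ []) IsFactorOf v
no-1001-in-σ₁-preimage G im f =
  Good.no-00010100 G (pure , image-factor {x = 1F ∷ 0F ∷ 0F ∷ 1F ∷ []} im f)

-- The image of 1001 under σ₀ is 00101000; with the 0 that precedes it, unless
-- it starts the word, it contains 00010100.
no-1001-in-σ₀-preimage : Good w → w ImageOf v [ 0F ] → v 0 ≡ 0F →
                         ¬ (1F ∷ 0F ∷ 0F ∷ 1F ∷ []) IsFactorOf v
no-1001-in-σ₀-preimage G im         v₀ (zero  , s) = 0≢1 v₀ (∷-injectiveˡ s)
no-1001-in-σ₀-preimage G (image eq) v₀ (suc i , s) =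
  no-1001-in-σ₁-preimage (good-suffix₁ G) (image (eq ∘ suc)) (i , s)

-- The next 1 is not at distance 1 (by 11) or 3 (by 1001), nor beyond 4 (by 0000); distances 2 and 4
-- keep the parity.
zeros-after-one : Good w → w 0 ≡ 1F → ∀ j → w (1 + j * 2) ≡ 0F
zeros-after-one {w} G w₀ zero with w 1 in w₁
... | 0F = refl
... | 1F = ⊥-elim (Good.no-11 G (factor w 0 (w₀ ∷ w₁ ∷ [])))
zeros-after-one {w} G w₀ (suc j) with w 2 in w₂ | w 3 in w₃ | w 4 in w₄
... | 1F | _  | _  = zeros-after-one (good-suffix₁ (good-suffix₁ G)) w₂ j
... | 0F | 1F | _  = ⊥-elim (Good.no-1001 G
  (factor w 0 (w₀ ∷ zeros-after-one G w₀ 0 ∷ w₂ ∷ w₃ ∷ [])))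
... | 0F | 0F | 0F = ⊥-elim (Good.no-0000 G
  (pure , factor w 1 (zeros-after-one G w₀ 0 ∷ w₂ ∷ w₃ ∷ w₄ ∷ [])))
... | 0F | 0F | 1F = next-one j
  where
  next-one : ∀ j → w (3 + j * 2) ≡ 0F
  next-one zero    = w₃
  next-one (suc j) = zeros-after-one (good-suffix₁ (good-suffix₁ (good-suffix₁ (good-suffix₁ G)))) w₄ j

σ₀-unique : (∀ j → w (j * 2) ≡ opposite (v j)) → (∀ j → w (1 + j * 2) ≡ 0F) → w ≗ σ 0F v
σ₀-unique even odd zero       = even 0
σ₀-unique even odd (suc zero) = odd 0
σ₀-unique {w} {v} even odd (suc (suc n)) =
  σ₀-unique {suffix 2 w} {suffix 1 v} (even ∘ suc) (odd ∘ suc) n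

GoodPreimage : Letter → Word∞ → Set
GoodPreimage c w = ∃ λ v → w ImageOf v [ c ] × Good v

σ₀-preimage : Good w → w 0 ≡ 1F → GoodPreimage 0F w
σ₀-preimage {w} G w₀ = u , im , good-preimage G im (no-1001-in-σ₀-preimage G im (cong opposite w₀))
  where
  u : Word∞
  u j = opposite (w (j * 2))
  im : w ImageOf u [ 0F ]
  im = image (σ₀-unique (λ j → sym (opposite-involutive _)) (zeros-after-one G w₀))

-- Excluding 0000 forces a 1 at position 3, and from there on the 1s stay at odd positions.
σ₁-preimage : Good w → w ≗[ 3 ] const 0F → GoodPreimage 1F w
σ₁-preimage {w} G zeros = u , im , good-preimage G im (no-1001-in-σ₁-preimage G im)
  where
  w₀ = zeros 0 z<s
  w₁ = zeros 1 (s<s z<s)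
  w₂ = zeros 2 (s<s (s<s z<s))
  w₃ : w 3 ≡ 1F
  w₃ with w 3 in eq
  ... | 1F = refl
  ... | 0F = ⊥-elim (Good.no-0000 G (pure , factor w 0 (w₀ ∷ w₁ ∷ w₂ ∷ eq ∷ [])))
  u : Word∞
  u j = opposite (w (1 + j * 2))
  even : ∀ j → w (2 + j * 2) ≡ 0F
  even zero    = w₂
  even (suc j) = zeros-after-one (good-suffix₁ (good-suffix₁ (good-suffix₁ G))) w₃ j
  im : w ImageOf u [ 1F ]
  im = image λ where
    zero    → w₀
    (suc n) → σ₀-unique {suffix 1 w} {u} (λ j → sym (opposite-involutive _)) even n

-- Extremality

-- W₀ is to be the greatest and W₁ the least good word: at a first difference
-- a good word must have the letter c where W c has the opposite one.
BeatenAt : Letter → Word∞ → ℕ → Set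
BeatenAt c w n = w n ≡ W c n ⊎ (w n ≡ c × W c n ≡ opposite c)

beaten-by-opposite : ∀ c w n → W c n ≡ opposite c → BeatenAt c w n
beaten-by-opposite c w n eq with w n | c
... | 0F | 0F = inj₂ (refl , eq)
... | 0F | 1F = inj₁ (sym eq)
... | 1F | 0F = inj₁ (sym eq)
... | 1F | 1F = inj₂ (refl , eq)

-- Position `suc n` holds either an inserted 0, common to both words, or the opposite of letter j of
-- the preimages, which agree before j, where j is at most n.
beaten-image : ∀ n → w ImageOf v [ c ] →
               (∀ j → j < suc n → v ≗[ j ] W (opposite c) → BeatenAt (opposite c) v j) →
               w ≗[ suc n ] W c → BeatenAt c w (suc n)
beaten-image {w} {v} {c} n im ih agree with position c (suc n)
... | j , inj₂ eq = inj₁ (trans (is-zero im) (sym (is-zero (W-image c))))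
  where
  is-zero : w′ ImageOf v′ [ c ] → w′ (suc n) ≡ 0F
  is-zero {v′ = v′} (image e) = trans (e (suc n)) (trans (cong (σ c v′) eq) (σ-zero c v′ j))
... | j , inj₁ eq = map same differ (ih j j<1+n preimages-agree)
  where
  letter : w′ ImageOf v′ [ c ] → w′ (suc n) ≡ opposite (v′ j)
  letter {v′ = v′} (image e) = trans (e (suc n)) (trans (cong (σ c v′) eq) (σ-letter c v′ j))
  same : v j ≡ W (opposite c) j → w (suc n) ≡ W c (suc n)
  same e = trans (letter im) (trans (cong opposite e) (sym (letter (W-image c))))
  differ : v j ≡ opposite c × W (opposite c) j ≡ opposite (opposite c) →
           w (suc n) ≡ c × W c (suc n) ≡ opposite c
  differ (e , e′) = trans (letter im) (trans (cong opposite e) (opposite-involutive c))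
                  , trans (letter (W-image c)) (trans (cong opposite e′) (opposite-involutive _))
  2j≤1+n : j * 2 ≤ suc n
  2j≤1+n = ≤-trans (m≤n+m (j * 2) (toℕ c)) (≤-reflexive (sym eq))
  j<1+n : j < suc n
  j<1+n = s≤s (half-bound j 2j≤1+n)
  preimages-agree : v ≗[ j ] W (opposite c)
  preimages-agree = halve im (W-image c) λ i i<2j → agree i (<-≤-trans i<2j 2j≤1+n)

beaten : ∀ c n → Good w → w ≗[ n ] W c → BeatenAt c w n
beaten c n = go c n (<-wellFounded n)
  where
  go : ∀ c n → Acc _<_ n → Good w → w ≗[ n ] W c → BeatenAt c w n
  -- `W 0F` starts with 1 and `W 1F` with 000, the best possible letters; agreement with these
  -- prefixes yields the preimages used below.
  go {w} 0F 0 _ _ _ = beaten-by-opposite 0F w 0 refl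
  go {w} 1F 0 _ _ _ = beaten-by-opposite 1F w 0 refl
  go {w} 1F 1 _ _ _ = beaten-by-opposite 1F w 1 refl
  go {w} 1F 2 _ _ _ = beaten-by-opposite 1F w 2 refl
  go 0F (suc n) (acc rs) G agree =
    let _ , im , G′ = σ₀-preimage G (agree 0 z<s)
    in beaten-image n im (λ j j<n → go 1F j (rs j<n) G′) agree
  go {w} 1F (suc n@(suc (suc _))) (acc rs) G agree =
    let _ , im , G′ = σ₁-preimage G starts-with-000
    in beaten-image n im (λ j j<n → go 0F j (rs j<n) G′) agree
    where
    starts-with-000 : w ≗[ 3 ] const 0F
    starts-with-000 0 _ = agree 0 z<s
    starts-with-000 1 _ = agree 1 (s<s z<s)
    starts-with-000 2 _ = agree 2 (s<s (s<s z<s))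
    starts-with-000 (suc (suc (suc _))) (s≤s (s≤s (s≤s ())))

-- Lexicographic order and uniqueness of the limits

lex-from-first-difference : ∀ n → (∀ j → v ≗[ j ] w → v j ≡ w j ⊎ v j Fin.< w j) →
                            prefix n v ≤ₗₑₓ prefix n w
lex-from-first-difference zero    _ = base _
lex-from-first-difference {v} {w} (suc n) first with first 0 (λ _ ())
... | inj₂ lt = this lt refl
... | inj₁ eq = next eq (lex-from-first-difference n λ j agree → first (suc j) λ where
    zero    _         → eq
    (suc i) (s≤s i<j) → agree i i<j)

W₀-greatest : IsLimitOfGreatest (W 0F)
W₀-greatest n = (W 0F , W-good 0F , refl) , λ where
  _ (w , G , refl) → lex-from-first-difference n λ j agree →
    map₂ (λ (w≡0 , W≡1) → subst₂ Fin._<_ (sym w≡0) (sym W≡1) z<s) (beaten 0F j G agree)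

W₁-least : IsLimitOfLeast (W 1F)
W₁-least n = (W 1F , W-good 1F , refl) , λ where
  _ (w , G , refl) → lex-from-first-difference n λ j agree →
    map sym (λ (w≡1 , W≡0) → subst₂ Fin._<_ (sym W≡0) (sym w≡1) z<s)
      (beaten 1F j G (λ i i<j → sym (agree i i<j)))

≤ₗₑₓ-antisym : {x y : Vec Letter n} → x ≤ₗₑₓ y → y ≤ₗₑₓ x → x ≡ y
≤ₗₑₓ-antisym x≤y y≤x = Pointwise-≡⇒≡ (≤-antisym sym Fin.<-irrefl Fin.<-asym x≤y y≤x)

prefixes-determine : (∀ n → prefix n v ≡ prefix n w) → v ≗ w
prefixes-determine eq zero    = ∷-injectiveˡ (eq 1)
prefixes-determine eq (suc n) = prefixes-determine (λ k → ∷-injectiveʳ (eq (suc k))) n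

greatest-unique : IsLimitOfGreatest v → IsLimitOfGreatest w → v ≗ w
greatest-unique V V′ = prefixes-determine λ n →
  ≤ₗₑₓ-antisym (proj₂ (V′ n) _ (proj₁ (V n))) (proj₂ (V n) _ (proj₁ (V′ n)))

least-unique : IsLimitOfLeast v → IsLimitOfLeast w → v ≗ w
least-unique V V′ = prefixes-determine λ n →
  ≤ₗₑₓ-antisym (proj₂ (V n) _ (proj₁ (V′ n))) (proj₂ (V′ n) _ (proj₁ (V n)))

the-fixed-point : ∀ c {h} → (∀ v → apply∞ h v ≗ σ c (σ (opposite c) v)) →
                  w ≗ W c → IsTheFixedPoint h w
the-fixed-point {w} c {h} apply∞-h w≗W =
    (λ n → trans (fixed n) (sym (apply∞-h w n)))
  , λ v v-fixed → σσ-fixed-unique c (λ n → trans (v-fixed n) (apply∞-h v n)) fixed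
  where
  fixed : w ≗ σ c (σ (opposite c) w)
  fixed n = trans (w≗W n) (trans (W-fixed c n)
    (sym (σ-cong c (σ-cong (opposite c) w≗W) n)))

theorem4p5 : (∃ IsLimitOfGreatest × (∀ m → IsLimitOfGreatest m → IsTheFixedPoint h₁ m))
    × (∃ IsLimitOfLeast × (∀ ℓ → IsLimitOfLeast ℓ → IsTheFixedPoint h₂ ℓ))
theorem4p5 =
    ((W 0F , W₀-greatest) , λ m M → the-fixed-point 0F apply∞-h₁ (greatest-unique M W₀-greatest))
  , ((W 1F , W₁-least)    , λ ℓ L → the-fixed-point 1F apply∞-h₂ (least-unique L W₁-least))
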